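{- Let $G=(V,E)$ be an undirected graph, let $K$ be the set of in-degree vectors of all orientations of $G$, and let $C_1\subset\dots\subset C_q=V$, $\{S_1,\dots,S_q\}$ and $\beta_1>\dots>\beta_q$ be the canonical chain, canonical partition and essential value-sequence of $K$. An orientation $D$ of $G$ is decreasingly minimal if and only if $\varrho_D(C_i)=0$ for each $i=1,\dots,q$ and $\beta_i-1\le\varrho_D(v)\le\beta_i$ for every node $v\in S_i$ $(i=1,\dots,q)$.
   Context: $\varrho_D(v)$ is the number of arcs of $D$ with head $v$, and $\varrho_D(X)$ the number of arcs entering $X$ (head in $X$, tail outside). The in-degree vector of $D$ is $(\varrho_D(v))_{v\in V}$. An orientation is decreasingly minimal if its in-degree vector is decreasingly minimal in $K$ (largest component as small as possible, then the second largest, etc.). Canonical objects: take a decreasingly minimal $m\in K$; for $u\in V$ let $T_m(u)=\{s\in V: m+\chi_s-\chi_u\in K\}$. Put $\beta_1=\max_v m(v)$, $C_1=\bigcup\{T_m(u):m(u)=\beta_1\}$; for $i\ge2$, while $C_{i-1}\ne V$, put $\beta_i=\max\{m(s):s\in V-C_{i-1}\}$, $C_i=\bigcup\{T_m(u):m(u)\ge\beta_i\}$; stop when $C_q=V$; $S_i=C_i-C_{i-1}$ with $C_0=\emptyset$. These objects are known not to depend on the choice of $m$. -}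

module Defs where

open import Data.Bool.Base using (Bool; if_then_else_)
open import Data.Fin.Base using (Fin; zero; suc; inject₁; fromℕ)
open import Data.Fin.Properties using (_≟_)
open import Data.Fin.Subset using (Subset; _∈_; _∉_; ⊤; _─_)
open import Data.Fin.Subset.Properties using (_∈?_)
open import Data.Integer.Base using (ℤ; +_; _+_; _-_; _≤_; _<_; _≥_; 0ℤ; 1ℤ)
open import Data.Integer.Properties using (≤-decTotalOrder)
open import Data.List.Base using (List; length; filter; allFin)
open import Data.List.Relation.Binary.Lex.Strict using (Lex-≤)
import Data.List.Sort as Sort
open import Data.Nat.Base using (ℕ)
open import Data.Product.Base using (_×_; _,_; ∃-syntax; proj₁; proj₂)
open import Data.Unit.Base using () renaming (⊤ to Unit)
open import Data.Vec.Functional using (Vector; toList)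
open import Function.Bundles using (_⇔_)
open import Level using (0ℓ)
open import Relation.Binary.Construct.Flip.EqAndOrd using () renaming (decTotalOrder to flipOrder)
open import Relation.Binary.PropositionalEquality using (_≡_; _≢_; _≗_)
open import Relation.Nullary.Decidable using (does; ¬?; _×-dec_)
open import Relation.Unary using (Pred)

private
  variable
    n : ℕ

-- A finite undirected graph on the node set Fin n; parallel edges and
-- loops are allowed.  The order of the two ends of an edge is only a
-- reference order, with respect to which orientations are encoded.
record Graph (n : ℕ) : Set where
  field
    #edges : ℕ
    ends   : Fin #edges → Fin n × Fin n

open Graph public

-- D e ≡ true: e is directed from its first end to its second end;
-- D e ≡ false: the other way round.
Orientation : Graph n → Set
Orientation G = Fin (#edges G) → Bool

module _ (G : Graph n) (D : Orientation G) where

  head tail : Fin (#edges G) → Fin n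
  head e = if D e then proj₂ (ends G e) else proj₁ (ends G e)
  tail e = if D e then proj₁ (ends G e) else proj₂ (ends G e)

  ϱ : Fin n → ℕ
  ϱ v = length (filter (λ e → head e ≟ v) (allFin (#edges G)))

  ϱ-set : Subset n → ℕ
  ϱ-set X =
    length (filter (λ e → (head e ∈? X) ×-dec ¬? (tail e ∈? X)) (allFin (#edges G)))

  inDegreeVector : Vector ℤ n
  inDegreeVector v = + ϱ v

InDegreeVectors : Graph n → Pred (Vector ℤ n) 0ℓ
InDegreeVectors G x = ∃[ D ] x ≗ inDegreeVector G D

open Sort (flipOrder ≤-decTotalOrder) using () renaming (sort to sortDecreasing)

infix 8 _↓
_↓ : Vector ℤ n → List ℤ
x ↓ = sortDecreasing (toList x)

infix 4 _≤dec_
_≤dec_ : Vector ℤ n → Vector ℤ n → Set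
x ≤dec y = Lex-≤ _≡_ _<_ (x ↓) (y ↓)

DecreasinglyMinimal : Pred (Vector ℤ n) 0ℓ → Pred (Vector ℤ n) 0ℓ
DecreasinglyMinimal K x = K x × (∀ y → K y → x ≤dec y)

IsDecMinOrientation : (G : Graph n) → Orientation G → Set
IsDecMinOrientation G D =
  DecreasinglyMinimal (InDegreeVectors G) (inDegreeVector G D)

χ : Fin n → Vector ℤ n
χ s v = if does (v ≟ s) then 1ℤ else 0ℤ

T : Pred (Vector ℤ n) 0ℓ → Vector ℤ n → Fin n → Pred (Fin n) 0ℓ
T K m u s = K (λ v → (m v + χ s v) - χ u v)

IsMaxOver : Pred (Fin n) 0ℓ → Vector ℤ n → ℤ → Set
IsMaxOver P m b = (∃[ s ] (P s × m s ≡ b)) × (∀ s → P s → m s ≤ b)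

IsUnionOfT : Pred (Vector ℤ n) 0ℓ → Vector ℤ n → Pred ℤ 0ℓ → Subset n → Set
IsUnionOfT K m Q X = ∀ s → s ∈ X ⇔ (∃[ u ] (Q (m u) × T K m u s))

-- The objects produced by the iterative construction from m.  The chain
-- has q = 1 + q-1 members; the index j : Fin (1 + q-1) stands for the
-- (toℕ j + 1)-st member.  The fields determine q-1, C and β uniquely
-- from K and m.
record CanonicalChain (K : Pred (Vector ℤ n) 0ℓ) (m : Vector ℤ n) : Set where
  field
    q-1 : ℕ

  Index : Set
  Index = Fin (ℕ.suc q-1)

  field
    C      : Index → Subset n
    β      : Index → ℤ
    β-head : IsMaxOver (λ _ → Unit) m (β zero)
    C-head : IsUnionOfT K m (_≡ β zero) (C zero)
    C-cont : ∀ (i : Fin q-1) → C (inject₁ i) ≢ ⊤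
    β-step : ∀ (i : Fin q-1) → IsMaxOver (_∉ C (inject₁ i)) m (β (suc i))
    C-step : ∀ (i : Fin q-1) → IsUnionOfT K m (_≥ β (suc i)) (C (suc i))
    C-stop : C (fromℕ q-1) ≡ ⊤

  S : Index → Subset n
  S zero    = C zero
  S (suc i) = C (suc i) ─ C (inject₁ i)

{-# OPTIONS --safe #-}

-- Let y be the in-degree vector of D, and let D₀ realise m.
-- Reversing walks shows that s ∈ T_m(u) iff u is reachable from s in D₀, so no
-- arc of D₀ enters C_i, and y(C_i) - m(C_i) = ϱ_D(C_i) for every D.  An exchange
-- argument puts m(v) in {β_i - 1, β_i} for v ∈ S_i.
--
-- If D is decreasingly minimal, y is a rearrangement of m, hence Σ y² = Σ m².
-- On S_i replace the square by its secant through β_i - 1 and β_i, of slope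
-- c_i = 2 β_i - 1, which lies below it at all other integers.  Abel summation gives
--   0 = Σ y² - Σ m² = Σ_i (c_i - c_{i+1}) ϱ_D(C_i) + (a sum of non-negative defects),
-- where c_i > c_{i+1}, so every ϱ_D(C_i) and every defect vanishes.
--
-- Conversely, any function f is affine on {β_i - 1, β_i}, so y(S_i) = m(S_i) gives
-- Σ f(y) = Σ f(m).  For f(z) = bᶻ with b > n, comparing Σ f amounts to comparing
-- in the decreasing order.

module Submission where

open import Defs
open import Data.Bool.Base using (true; false; not; if_then_else_)
import Data.Bool.Properties as Bool
open import Data.Fin.Base using (Fin; zero; suc; inject₁; fromℕ)
open import Data.Fin.Induction using (<-weakInduction; >-weakInduction)
open import Data.Fin.Properties using (_≟_; any?)
open import Data.Fin.Subset using (Subset; _∈_; _∉_; _⊆_; ⊤; _─_)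
open import Data.Fin.Subset.Properties using (_∈?_; ∈⊤; p─q⊆p; x∈p∧x∉q⇒x∈p─q)
open import Data.Integer.Base hiding (suc; pred)
open import Data.Integer.Properties hiding (_≟_)
open import Data.Integer.Tactic.RingSolver using (solve-∀)
open import Data.List.Base using (List; []; _∷_; length; filter; tabulate)
import Data.List.Properties as List
open import Data.List.Relation.Binary.Lex.Strict using (Lex-≤; Lex-<; base; halt; this; next)
import Data.List.Relation.Binary.Lex.Strict as Lex
open import Data.List.Relation.Binary.Permutation.Propositional using (_↭_; prep; swap; ↭-sym)
import Data.List.Relation.Binary.Permutation.Propositional as ↭
open import Data.List.Relation.Binary.Permutation.Propositional.Properties using (All-resp-↭; ↭-length)
import Data.List.Relation.Binary.Pointwise as Pointwise
open import Data.List.Relation.Unary.All using (All; []; _∷_)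
open import Data.List.Relation.Unary.All.Properties using (tabulate⁺)
open import Data.List.Relation.Unary.AllPairs using (AllPairs; []; _∷_)
open import Data.List.Relation.Unary.Sorted.TotalOrder.Properties using (Sorted⇒AllPairs)
import Data.List.Sort as Sort
open import Data.Nat.Base using (ℕ; zero; suc; z≤n; s≤s)
import Data.Nat.Base as ℕ
import Data.Nat.Properties as ℕ
open import Data.Product.Base using (_×_; _,_; ∃-syntax; proj₁; proj₂)
open import Data.Sum.Base using (_⊎_; inj₁; inj₂)
open import Data.Vec.Base using (_∷_; there)
open import Data.Vec.Functional using (Vector; toList)
open import Function.Base using (_∘_)
open import Function.Bundles using (_⇔_; mk⇔; Equivalence)
open import Level using (0ℓ)
open import Relation.Binary.Bundles using (DecTotalOrder)
open import Relation.Binary.Construct.Flip.EqAndOrd using () renaming (decTotalOrder to flipOrder)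
open import Relation.Binary.PropositionalEquality using (_≡_; _≢_; refl; sym; cong; trans; cong₂; subst; subst₂; module ≡-Reasoning)
open import Relation.Nullary.Decidable using (Dec; yes; no; does; ¬?; _×-dec_)
open import Relation.Nullary.Negation using (¬_; contradiction)
open import Relation.Unary using (Pred; Decidable)

open import Algebra.Properties.Semiring.Sum +-*-semiring
  using (sum; sum-syntax; sum-cong-≗; ∑-distrib-+; ∑-comm; *-distribˡ-sum)

private
  variable
    n : ℕ

-- The Iverson bracket. It has the same shape as `χ`, so that `χ s v` unfolds to `⟦ v ≟ s ⟧`.
⟦_⟧ : ∀ {p} {P : Set p} → Dec P → ℤ
⟦ P? ⟧ = if does P? then 1ℤ else 0ℤ

⟦⟧-nonneg : ∀ {p} {P : Set p} (P? : Dec P) → 0ℤ ≤ ⟦ P? ⟧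
⟦⟧-nonneg (yes _) = +≤+ z≤n
⟦⟧-nonneg (no  _) = +≤+ z≤n

-- Finite sums

sum-mono-≤ : {f g : Vector ℤ n} → (∀ i → f i ≤ g i) → sum f ≤ sum g
sum-mono-≤ {n = zero}  f≤g = ≤-refl
sum-mono-≤ {n = suc n} f≤g = +-mono-≤ (f≤g zero) (sum-mono-≤ (f≤g ∘ suc))

sum-nonneg : {f : Vector ℤ n} → (∀ i → 0ℤ ≤ f i) → 0ℤ ≤ sum f
sum-nonneg {n = zero}  0≤f = ≤-refl
sum-nonneg {n = suc n} 0≤f = +-mono-≤ (0≤f zero) (sum-nonneg (0≤f ∘ suc))

i+j≡0⇒i≡0×j≡0 : ∀ {i j} → 0ℤ ≤ i → 0ℤ ≤ j → i + j ≡ 0ℤ → i ≡ 0ℤ × j ≡ 0ℤ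
i+j≡0⇒i≡0×j≡0 {+ zero} {+ zero} _ _ _ = refl , refl

sum≡0⇒≡0 : {f : Vector ℤ n} → (∀ i → 0ℤ ≤ f i) → sum f ≡ 0ℤ → ∀ i → f i ≡ 0ℤ
sum≡0⇒≡0 0≤f eq zero    = proj₁ (i+j≡0⇒i≡0×j≡0 (0≤f zero) (sum-nonneg (0≤f ∘ suc)) eq)
sum≡0⇒≡0 0≤f eq (suc i) =
  sum≡0⇒≡0 (0≤f ∘ suc) (proj₂ (i+j≡0⇒i≡0×j≡0 (0≤f zero) (sum-nonneg (0≤f ∘ suc)) eq)) i

sum-<⇒∃< : (f g : Vector ℤ n) → sum f < sum g → ∃[ i ] f i < g i
sum-<⇒∃< f g ∑f<∑g with any? (λ i → f i <? g i)
... | yes f<g = f<g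
... | no ¬f<g = contradiction (sum-mono-≤ (λ i → ≮⇒≥ (λ fi<gi → ¬f<g (i , fi<gi)))) (<⇒≱ ∑f<∑g)

sum-zero : {f : Vector ℤ n} → (∀ i → f i ≡ 0ℤ) → sum f ≡ 0ℤ
sum-zero {n = zero}  f≡0 = refl
sum-zero {n = suc n} f≡0 = cong₂ _+_ (f≡0 zero) (sum-zero (f≡0 ∘ suc))

∑-distrib-- : (f g : Vector ℤ n) → sum (λ i → f i - g i) ≡ sum f - sum g
∑-distrib-- {zero}  f g = refl
∑-distrib-- {suc n} f g =
  trans (cong (_+_ (f zero - g zero)) (∑-distrib-- (f ∘ suc) (g ∘ suc)))
          (rearrange (f zero) (g zero) (sum (f ∘ suc)) (sum (g ∘ suc)))
  where
  rearrange : ∀ a b c d → (a - b) + (c - d) ≡ (a + c) - (b + d)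
  rearrange = solve-∀

-- Sifting: a change made at one node or one arc can be written as a pointwise correction
-- `χ s v * f v`, whose sum is then read off.
sum-χ : (s : Fin n) (f : Vector ℤ n) → ∑[ v < n ] (χ s v * f v) ≡ f s
sum-χ zero    f = trans (cong₂ _+_ (*-identityˡ (f zero)) (sum-zero (λ v → *-zeroˡ (f (suc v)))))
                          (+-identityʳ (f zero))
sum-χ (suc s) f = trans (+-identityˡ _) (sum-χ s (f ∘ suc))

-- Needed because `ϱ` tests `head e ≟ v`, while `χ` compares its two nodes in the other order.
χ-sym : (s v : Fin n) → ⟦ s ≟ v ⟧ ≡ χ s v
χ-sym s v with s ≟ v | v ≟ s
... | yes _   | yes _   = refl
... | no  _   | no  _   = refl
... | yes s≡v | no  v≢s = contradiction (sym s≡v) v≢s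
... | no  s≢v | yes v≡s = contradiction (sym v≡s) s≢v

χ-≡ : (s : Fin n) → χ s s ≡ 1ℤ
χ-≡ s with s ≟ s
... | yes _   = refl
... | no  s≢s = contradiction refl s≢s

χ-≢ : {s v : Fin n} → v ≢ s → χ s v ≡ 0ℤ
χ-≢ {s = s} {v} v≢s with v ≟ s
... | yes v≡s = contradiction v≡s v≢s
... | no  _   = refl

-- The general `f` lets the induction pass to `f ∘ suc`; `allFin` is the case of the identity.
length-filter-tabulate : ∀ {A : Set} {P : Pred A 0ℓ} (P? : Decidable P) (f : Fin n → A) →
  + length (filter P? (tabulate f)) ≡ ∑[ i < n ] ⟦ P? (f i) ⟧
length-filter-tabulate {n = zero}  P? f = refl
length-filter-tabulate {n = suc n} P? f with does (P? (f zero))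
... | true  = cong (_+_ 1ℤ) (length-filter-tabulate P? (f ∘ suc))
... | false = trans (length-filter-tabulate P? (f ∘ suc)) (sym (+-identityˡ _))

-- Sums over a set of nodes

sumOn : Subset n → Vector ℤ n → ℤ
sumOn {n} X f = ∑[ v < n ] (⟦ v ∈? X ⟧ * f v)

sumOn-cong : (X : Subset n) {f g : Vector ℤ n} → (∀ v → v ∈ X → f v ≡ g v) → sumOn X f ≡ sumOn X g
sumOn-cong X {f} {g} f≡g = sum-cong-≗ pointwise
  where
  pointwise : ∀ v → ⟦ v ∈? X ⟧ * f v ≡ ⟦ v ∈? X ⟧ * g v
  pointwise v with v ∈? X
  ... | yes v∈X = cong (1ℤ *_) (f≡g v v∈X)
  ... | no  _   = refl

sumOn-⊤ : (f : Vector ℤ n) → sumOn ⊤ f ≡ sum f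
sumOn-⊤ f = sum-cong-≗ pointwise
  where
  pointwise : ∀ v → ⟦ v ∈? ⊤ ⟧ * f v ≡ f v
  pointwise v with v ∈? ⊤
  ... | yes _   = *-identityˡ (f v)
  ... | no  v∉⊤ = contradiction ∈⊤ v∉⊤

sumOn-distrib-- : (X : Subset n) (f g : Vector ℤ n) → sumOn X (λ v → f v - g v) ≡ sumOn X f - sumOn X g
sumOn-distrib-- X f g =
  trans (sum-cong-≗ (λ v → distrib ⟦ v ∈? X ⟧ (f v) (g v))) (∑-distrib-- (λ v → ⟦ v ∈? X ⟧ * f v) (λ v → ⟦ v ∈? X ⟧ * g v))
  where
  distrib : ∀ a b c → a * (b - c) ≡ a * b - a * c
  distrib = solve-∀

sumOn-*ˡ : (X : Subset n) (c : ℤ) (f : Vector ℤ n) → sumOn X (λ v → c * f v) ≡ c * sumOn X f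
sumOn-*ˡ X c f =
  trans (sum-cong-≗ (λ v → commute ⟦ v ∈? X ⟧ c (f v))) (sym (*-distribˡ-sum c (λ v → ⟦ v ∈? X ⟧ * f v)))
  where
  commute : ∀ a b c → a * (b * c) ≡ b * (a * c)
  commute = solve-∀

x∈p─q⇒x∉q : ∀ {x} (p q : Subset n) → x ∈ p ─ q → x ∉ q
x∈p─q⇒x∉q (_ ∷ p) (true  ∷ q) (there x∈p─q) (there x∈q) = x∈p─q⇒x∉q p q x∈p─q x∈q
x∈p─q⇒x∉q (_ ∷ p) (false ∷ q) (there x∈p─q) (there x∈q) = x∈p─q⇒x∉q p q x∈p─q x∈q

sumOn-─ : {X Y : Subset n} → X ⊆ Y → (f : Vector ℤ n) → sumOn Y f ≡ sumOn X f + sumOn (Y ─ X) f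
sumOn-─ {X = X} {Y} X⊆Y f =
  trans (sum-cong-≗ pointwise) (∑-distrib-+ (λ v → ⟦ v ∈? X ⟧ * f v) (λ v → ⟦ v ∈? Y ─ X ⟧ * f v))
  where
  pointwise : ∀ v → ⟦ v ∈? Y ⟧ * f v ≡ ⟦ v ∈? X ⟧ * f v + ⟦ v ∈? Y ─ X ⟧ * f v
  pointwise v with v ∈? Y | v ∈? X | v ∈? Y ─ X
  ... | yes _   | yes _   | no  _   = sym (+-identityʳ _)
  ... | yes _   | no  _   | yes _   = sym (+-identityˡ _)
  ... | no  _   | no  _   | no  _   = refl
  ... | yes v∈Y | no  v∉X | no  v∉S = contradiction (x∈p∧x∉q⇒x∈p─q v∈Y v∉X) v∉S
  ... | no  v∉Y | yes v∈X | _       = contradiction (X⊆Y v∈X) v∉Y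
  ... | no  v∉Y | no  _   | yes v∈S = contradiction (p─q⊆p Y X v∈S) v∉Y
  ... | yes _   | yes v∈X | yes v∈S = contradiction v∈X (x∈p─q⇒x∉q Y X v∈S)

module _ (X : Subset n) {f : Vector ℤ n} (0≤f : ∀ v → v ∈ X → 0ℤ ≤ f v) where

  private
    0≤term : ∀ v → 0ℤ ≤ ⟦ v ∈? X ⟧ * f v
    0≤term v with v ∈? X
    ... | yes v∈X = subst (0ℤ ≤_) (sym (*-identityˡ (f v))) (0≤f v v∈X)
    ... | no  _   = ≤-refl

  sumOn-nonneg : 0ℤ ≤ sumOn X f
  sumOn-nonneg = sum-nonneg 0≤term

  sumOn≡0⇒≡0 : sumOn X f ≡ 0ℤ → ∀ v → v ∈ X → f v ≡ 0ℤ
  sumOn≡0⇒≡0 eq v v∈X with v ∈? X | sum≡0⇒≡0 0≤term eq v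
  ... | yes _   | 1*f≡0 = trans (sym (*-identityˡ (f v))) 1*f≡0
  ... | no  v∉X | _     = contradiction v∈X v∉X

-- Reversing walks

module _ (G : Graph n) where

  private
    Arc : Set
    Arc = Fin (#edges G)

  ϱ-as-sum : (D : Orientation G) (v : Fin n) → + ϱ G D v ≡ ∑[ e < #edges G ] χ (head G D e) v
  ϱ-as-sum D v = trans (length-filter-tabulate (λ e → head G D e ≟ v) (λ e → e))
                       (sum-cong-≗ (λ e → χ-sym (head G D e) v))

  reverse : Orientation G → Arc → Orientation G
  reverse D e e′ = if does (e′ ≟ e) then not (D e′) else D e′

  reverse-≢ : (D : Orientation G) {e e′ : Arc} → e′ ≢ e → reverse D e e′ ≡ D e′
  reverse-≢ D {e} {e′} e′≢e with e′ ≟ e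
  ... | yes e′≡e = contradiction e′≡e e′≢e
  ... | no  _    = refl

  head-cong : (D D′ : Orientation G) (e : Arc) → D e ≡ D′ e → head G D e ≡ head G D′ e
  head-cong D D′ e = cong (λ b → if b then proj₂ (ends G e) else proj₁ (ends G e))

  tail-cong : (D D′ : Orientation G) (e : Arc) → D e ≡ D′ e → tail G D e ≡ tail G D′ e
  tail-cong D D′ e = cong (λ b → if b then proj₁ (ends G e) else proj₂ (ends G e))

  head-opposite : (D D′ : Orientation G) (e : Arc) → D e ≢ D′ e → head G D e ≡ tail G D′ e
  head-opposite D D′ e De≢D′e with D e | D′ e
  ... | true  | true  = contradiction refl De≢D′e
  ... | true  | false = refl
  ... | false | true  = refl
  ... | false | false = contradiction refl De≢D′e

  -- Only the summand of `e` changes, and `sum-χ` extracts it. For a loop the correction is zero.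
  ϱ-reverse : (D : Orientation G) (e : Arc) (v : Fin n) →
    + ϱ G (reverse D e) v ≡ + ϱ G D v + (χ (tail G D e) v - χ (head G D e) v)
  ϱ-reverse D e v = begin
    + ϱ G (reverse D e) v                          ≡⟨ ϱ-as-sum (reverse D e) v ⟩
    sum (λ e′ → χ (head G (reverse D e) e′) v)     ≡⟨ sum-cong-≗ pointwise ⟩
    sum (λ e′ → χ (head G D e′) v + χ e e′ * δ e′) ≡⟨ ∑-distrib-+ (λ e′ → χ (head G D e′) v) (λ e′ → χ e e′ * δ e′) ⟩
    sum (λ e′ → χ (head G D e′) v) + sum (λ e′ → χ e e′ * δ e′)
                                                   ≡⟨ cong₂ _+_ (sym (ϱ-as-sum D v)) (sum-χ e δ) ⟩
    + ϱ G D v + δ e                                ∎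
    where
    open ≡-Reasoning
    δ : Arc → ℤ
    δ e′ = χ (tail G D e′) v - χ (head G D e′) v
    replace : ∀ h t → t ≡ h + 1ℤ * (t - h)
    replace = solve-∀
    keep : ∀ h t → h ≡ h + 0ℤ * (t - h)
    keep = solve-∀
    pointwise : ∀ e′ → χ (head G (reverse D e) e′) v ≡ χ (head G D e′) v + χ e e′ * δ e′
    pointwise e′ with e′ ≟ e
    ... | no  _ = keep (χ (head G D e′) v) (χ (tail G D e′) v)
    ... | yes _ with D e′
    ...   | true  = replace (χ (proj₂ (ends G e′)) v) (χ (proj₁ (ends G e′)) v)
    ...   | false = replace (χ (proj₁ (ends G e′)) v) (χ (proj₂ (ends G e′)) v)

  -- The number bounds the length and need not equal it, as `[]` is available at every `k`. It is
  -- what decreases in `walk⇒T`, where the rest of a walk is replaced by a walk of another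
  -- orientation.
  data Walk (D : Orientation G) : ℕ → Fin n → Fin n → Set where
    []  : ∀ {k u} → Walk D k u u
    _∷_ : ∀ {k u} e → Walk D k (head G D e) u → Walk D (suc k) (tail G D e) u

  weaken : ∀ {D k s u} → Walk D k s u → Walk D (suc k) s u
  weaken []      = []
  weaken (e ∷ w) = e ∷ weaken w

  -- If the walk uses e, cut it after the last use of e.
  avoid : ∀ {D k s u} e → Walk D k s u →
    Walk (reverse D e) k s u ⊎ Walk (reverse D e) k (head G D e) u
  avoid e [] = inj₁ []
  avoid {D} {suc k} {u = u} e (e′ ∷ w) with avoid e w
  ... | inj₂ w′ = inj₂ (weaken w′)
  ... | inj₁ w′ with e′ ≟ e
  ...   | yes refl = inj₂ (weaken w′)
  ...   | no e′≢e  = inj₁ (subst (λ t → Walk (reverse D e) (suc k) t u) (tail-cong (reverse D e) D e′ (reverse-≢ D e′≢e))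
                      (e′ ∷ subst (λ h → Walk (reverse D e) k h u) (sym (head-cong (reverse D e) D e′ (reverse-≢ D e′≢e))) w′))

  -- Reversing the first arc moves a unit of in-degree from its head to its tail `s`; the rest of
  -- the walk, taken in the new orientation, then moves a unit from `u` to that head.
  walk⇒T : ∀ {D k s u} → Walk D k s u → T (InDegreeVectors G) (inDegreeVector G D) u s
  walk⇒T {D} {s = s} [] = D , λ v → cancel (+ ϱ G D v) (χ s v)
    where
    cancel : ∀ a b → (a + b) - b ≡ a
    cancel = solve-∀
  walk⇒T {D} {suc k} {u = u} (e ∷ w) = proj₁ reversed , λ v →
    trans (shift (+ ϱ G D v) (χ (tail G D e) v) (χ u v) (χ (head G D e) v))
      (trans (cong (λ a → (a + χ (head G D e) v) - χ u v) (sym (ϱ-reverse D e v)))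
             (proj₂ reversed v))
    where
    rest : Walk (reverse D e) k (head G D e) u
    -- Both outcomes are walks from the head of `e`, since `w` itself starts there.
    rest with avoid e w
    ... | inj₁ w′ = w′
    ... | inj₂ w′ = w′
    reversed = walk⇒T rest
    shift : ∀ a t u h → (a + t) - u ≡ ((a + (t - h)) + h) - u
    shift = solve-∀

  private
    differ : (D D′ : Orientation G) (e : Arc) → ℤ
    differ D D′ e = ⟦ ¬? (D e Bool.≟ D′ e) ⟧

    -- The Hamming distance. It falls by one with each restored arc and so bounds the walk built in
    -- `T⇒walk′`.
    distance : (D D′ : Orientation G) → ℤ
    distance D D′ = sum (differ D D′)

    differ-reverse : (D D′ : Orientation G) {e : Arc} → D e ≢ D′ e →
      ∀ e′ → differ D (reverse D′ e) e′ ≡ differ D D′ e′ - χ e e′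
    differ-reverse D D′ {e} De≢D′e e′ with e′ ≟ e
    ... | no  _    = sym (+-identityʳ _)
    ... | yes refl with D e′ | D′ e′
    ...   | true  | true  = contradiction refl De≢D′e
    ...   | true  | false = refl
    ...   | false | true  = refl
    ...   | false | false = contradiction refl De≢D′e

    distance-reverse : (D D′ : Orientation G) {e : Arc} → D e ≢ D′ e →
      distance D (reverse D′ e) ≡ distance D D′ - 1ℤ
    distance-reverse D D′ {e} De≢D′e = begin
      distance D (reverse D′ e)          ≡⟨ sum-cong-≗ (differ-reverse D D′ De≢D′e) ⟩
      sum (λ e′ → differ D D′ e′ - χ e e′) ≡⟨ ∑-distrib-- (differ D D′) (χ e) ⟩
      distance D D′ - sum (χ e)          ≡⟨ cong (_-_ (distance D D′)) ∑χ≡1 ⟩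
      distance D D′ - 1ℤ                 ∎
      where
      open ≡-Reasoning
      ∑χ≡1 : sum (χ e) ≡ 1ℤ
      ∑χ≡1 = trans (sum-cong-≗ (λ e′ → sym (*-identityʳ (χ e e′)))) (sum-χ e (λ _ → 1ℤ))

    -- A node s that gains an in-arc has an arc e in D that D′ reverses; restore
    -- it in D′ and continue from the head of e.
    T⇒walk′ : ∀ k {D D′ s u} → distance D D′ ≤ + k →
      (∀ v → (+ ϱ G D v + χ s v) - χ u v ≡ + ϱ G D′ v) → Walk D k s u
    T⇒walk′ k {D} {D′} {s} {u} dist≤k eq with s ≟ u
    ... | yes refl = []
    ... | no  s≢u  = step k dist≤k
      where
      -- As `s` differs from `u`, its in-degree in `D′` is one larger than in `D`, so some arc has
      -- head `s` in `D′` but not in `D`.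
      gain : sum (λ e → χ (head G D e) s) < sum (λ e → χ (head G D′ e) s)
      gain = subst₂ _<_ (ϱ-as-sum D s)
        (trans (cong₂ (λ a b → (+ ϱ G D s + a) - b) (sym (χ-≡ s)) (sym (χ-≢ s≢u)))
               (trans (eq s) (ϱ-as-sum D′ s)))
        (subst (+ ϱ G D s <_) (sym (+-identityʳ _)) (+<+ (ℕ.m<m+n _ (s≤s z≤n))))
      gaining = sum-<⇒∃< (λ e → χ (head G D e) s) (λ e → χ (head G D′ e) s) gain
      e = proj₁ gaining
      De≢D′e : D e ≢ D′ e
      De≢D′e De≡D′e =
        <-irrefl (cong (λ h → χ h s) (head-cong D D′ e De≡D′e)) (proj₂ gaining)
      χ-< : ∀ h h′ → χ h s < χ h′ s → h′ ≡ s
      χ-< h h′ lt with s ≟ h | s ≟ h′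
      ... | _     | yes s≡h′ = sym s≡h′
      ... | yes _ | no  _    = contradiction lt λ { (+<+ ()) }
      ... | no  _ | no  _    = contradiction lt λ { (+<+ ()) }
      head-D′≡s : head G D′ e ≡ s
      head-D′≡s = χ-< (head G D e) (head G D′ e) (proj₂ gaining)
      tail≡s : tail G D e ≡ s
      tail≡s = trans (sym (head-opposite D′ D e (De≢D′e ∘ sym))) head-D′≡s
      -- Restoring `e` in `D′` passes the extra unit from `s` to the head of `e` in `D`, so the
      -- hypothesis holds again with that head in place of `s`.
      eq′ : ∀ v → (+ ϱ G D v + χ (head G D e) v) - χ u v ≡ + ϱ G (reverse D′ e) v
      eq′ v = begin
        (+ ϱ G D v + χ (head G D e) v) - χ u v
          ≡⟨ shift (+ ϱ G D v) (χ (head G D e) v) (χ u v) (χ s v) ⟩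
        ((+ ϱ G D v + χ s v) - χ u v) + (χ (head G D e) v - χ s v)
          ≡⟨ cong₂ (λ a b → a + (b - χ s v)) (eq v) (cong (λ h → χ h v) (head-opposite D D′ e De≢D′e)) ⟩
        + ϱ G D′ v + (χ (tail G D′ e) v - χ s v)
          ≡⟨ cong (λ h → + ϱ G D′ v + (χ (tail G D′ e) v - χ h v)) (sym head-D′≡s) ⟩
        + ϱ G D′ v + (χ (tail G D′ e) v - χ (head G D′ e) v)
          ≡⟨ sym (ϱ-reverse D′ e v) ⟩
        + ϱ G (reverse D′ e) v ∎
        where
        open ≡-Reasoning
        shift : ∀ a h u s → (a + h) - u ≡ ((a + s) - u) + (h - s)
        shift = solve-∀
      0≤dist′ : 0ℤ ≤ distance D (reverse D′ e)
      0≤dist′ = sum-nonneg (λ e′ → ⟦⟧-nonneg (¬? (D e′ Bool.≟ reverse D′ e e′)))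
      dist′≤ : ∀ {j} → distance D D′ ≤ j → distance D (reverse D′ e) ≤ j - 1ℤ
      dist′≤ dist≤j = subst (_≤ _) (sym (distance-reverse D D′ De≢D′e)) (+-monoˡ-≤ -1ℤ dist≤j)
      step : ∀ k → distance D D′ ≤ + k → Walk D k s u
      -- At distance zero, restoring the differing arc `e` would make the distance negative.
      step zero    dist≤0 = contradiction (≤-trans 0≤dist′ (dist′≤ dist≤0)) λ ()
      step (suc k) dist≤k = subst (λ t → Walk D (suc k) t u) tail≡s
        (e ∷ T⇒walk′ k (dist′≤ dist≤k) eq′)

  T⇒walk : ∀ {D s u} → T (InDegreeVectors G) (inDegreeVector G D) u s → ∃[ k ] Walk D k s u
  T⇒walk {D} (D′ , eq) = ∣ distance D D′ ∣ , T⇒walk′ _ (≤-reflexive (sym (0≤i⇒+∣i∣≡i 0≤dist))) eq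
    where
    0≤dist : 0ℤ ≤ distance D D′
    0≤dist = sum-nonneg (λ e → ⟦⟧-nonneg (¬? (D e Bool.≟ D′ e)))

  -- In-degree sums over a node set

  internalEdges : Subset n → ℤ
  internalEdges X = sum (λ e → ⟦ proj₁ (ends G e) ∈? X ⟧ * ⟦ proj₂ (ends G e) ∈? X ⟧)

  -- An arc with head in `X` either has both ends in `X` or enters `X`, and the number of the first
  -- kind does not depend on the orientation.
  sumOn-ϱ : (D : Orientation G) (X : Subset n) →
    sumOn X (inDegreeVector G D) ≡ internalEdges X + + ϱ-set G D X
  sumOn-ϱ D X = begin
    sum (λ v → ⟦ v ∈? X ⟧ * + ϱ G D v)
      ≡⟨ sum-cong-≗ (λ v → trans (cong (⟦ v ∈? X ⟧ *_) (ϱ-as-sum D v)) (*-distribˡ-sum ⟦ v ∈? X ⟧ (λ e → χ (head G D e) v))) ⟩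
    sum (λ v → sum (λ e → ⟦ v ∈? X ⟧ * χ (head G D e) v))
      ≡⟨ ∑-comm (λ v e → ⟦ v ∈? X ⟧ * χ (head G D e) v) ⟩
    sum (λ e → sum (λ v → ⟦ v ∈? X ⟧ * χ (head G D e) v))
      ≡⟨ sum-cong-≗ (λ e → trans (sum-cong-≗ (λ v → *-comm ⟦ v ∈? X ⟧ (χ (head G D e) v))) (sum-χ (head G D e) (λ v → ⟦ v ∈? X ⟧))) ⟩
    sum (λ e → ⟦ head G D e ∈? X ⟧)
      ≡⟨ sum-cong-≗ pointwise ⟩
    sum (λ e → ⟦ proj₁ (ends G e) ∈? X ⟧ * ⟦ proj₂ (ends G e) ∈? X ⟧ + ⟦ entering e ⟧)
      ≡⟨ ∑-distrib-+ (λ e → ⟦ proj₁ (ends G e) ∈? X ⟧ * ⟦ proj₂ (ends G e) ∈? X ⟧) (λ e → ⟦ entering e ⟧) ⟩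
    internalEdges X + sum (λ e → ⟦ entering e ⟧)
      ≡⟨ cong (_+_ (internalEdges X)) (sym (length-filter-tabulate entering (λ e → e))) ⟩
    internalEdges X + + ϱ-set G D X ∎
    where
    open ≡-Reasoning
    entering : ∀ e → Dec (head G D e ∈ X × ¬ (tail G D e ∈ X))
    entering e = (head G D e ∈? X) ×-dec ¬? (tail G D e ∈? X)
    pointwise : ∀ e → ⟦ head G D e ∈? X ⟧ ≡
      ⟦ proj₁ (ends G e) ∈? X ⟧ * ⟦ proj₂ (ends G e) ∈? X ⟧ + ⟦ entering e ⟧
    pointwise e with D e
    ... | true with proj₁ (ends G e) ∈? X | proj₂ (ends G e) ∈? X
    ...   | yes _ | yes _ = refl
    ...   | yes _ | no  _ = refl
    ...   | no  _ | yes _ = refl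
    ...   | no  _ | no  _ = refl
    pointwise e | false with proj₁ (ends G e) ∈? X | proj₂ (ends G e) ∈? X
    ...   | yes _ | yes _ = refl
    ...   | yes _ | no  _ = refl
    ...   | no  _ | yes _ = refl
    ...   | no  _ | no  _ = refl

  ϱ-set≡0 : (D : Orientation G) (X : Subset n) →
    (∀ e → head G D e ∈ X → tail G D e ∈ X) → ϱ-set G D X ≡ 0
  ϱ-set≡0 D X closed =
    cong length (List.filter-none (λ e → (head G D e ∈? X) ×-dec ¬? (tail G D e ∈? X))
      (tabulate⁺ (λ e (h∈X , t∉X) → t∉X (closed e h∈X))))

-- The decreasing order

NonNegativeVector : Vector ℤ n → Set
NonNegativeVector x = ∀ v → 0ℤ ≤ x v

InDegreeVectors⇒nonneg : (G : Graph n) {x : Vector ℤ n} → InDegreeVectors G x → NonNegativeVector x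
InDegreeVectors⇒nonneg G (D , x≗ϱ) v = subst (0ℤ ≤_) (sym (x≗ϱ v)) (+≤+ z≤n)

listSum : (ℤ → ℤ) → List ℤ → ℤ
listSum f []       = 0ℤ
listSum f (x ∷ xs) = f x + listSum f xs

listSum-↭ : (f : ℤ → ℤ) {xs ys : List ℤ} → xs ↭ ys → listSum f xs ≡ listSum f ys
listSum-↭ f ↭.refl         = refl
listSum-↭ f (prep x p)     = cong (_+_ (f x)) (listSum-↭ f p)
listSum-↭ f (swap {xs} x y p) =
  trans (exchange (f x) (f y) (listSum f xs)) (cong (λ a → f y + (f x + a)) (listSum-↭ f p))
  where
  exchange : ∀ a b c → a + (b + c) ≡ b + (a + c)
  exchange = solve-∀
listSum-↭ f (↭.trans p q)  = trans (listSum-↭ f p) (listSum-↭ f q)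

listSum-toList : (f : ℤ → ℤ) (x : Vector ℤ n) → listSum f (toList x) ≡ sum (λ v → f (x v))
listSum-toList {zero}  f x = refl
listSum-toList {suc n} f x = cong (_+_ (f (x zero))) (listSum-toList f (λ v → x (suc v)))

open DecTotalOrder (flipOrder ≤-decTotalOrder) using () renaming (totalOrder to ≥-totalOrder)
open Sort (flipOrder ≤-decTotalOrder) using (sort-↭; sort-↗)

listSum-↓ : (f : ℤ → ℤ) (x : Vector ℤ n) → listSum f (x ↓) ≡ sum (λ v → f (x v))
listSum-↓ f x = trans (listSum-↭ f (sort-↭ (toList x))) (listSum-toList f x)

↓-length : (x : Vector ℤ n) → length (x ↓) ≡ n
↓-length x = trans (↭-length (sort-↭ (toList x))) (List.length-tabulate x)

↓-nonneg : {x : Vector ℤ n} → NonNegativeVector x → All (0ℤ ≤_) (x ↓)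
↓-nonneg {x = x} 0≤x = All-resp-↭ (↭-sym (sort-↭ (toList x))) (tabulate⁺ 0≤x)

↓-decreasing : (x : Vector ℤ n) → AllPairs _≥_ (x ↓)
↓-decreasing x = Sorted⇒AllPairs ≥-totalOrder (sort-↗ (toList x))

Lex-≤⇒≡⊎Lex-< : ∀ {xs ys} → Lex-≤ _≡_ _<_ xs ys → xs ≡ ys ⊎ Lex-< _≡_ _<_ xs ys
Lex-≤⇒≡⊎Lex-< (base _)   = inj₁ refl
Lex-≤⇒≡⊎Lex-< halt       = inj₂ halt
Lex-≤⇒≡⊎Lex-< (this x<y) = inj₂ (this x<y)
Lex-≤⇒≡⊎Lex-< (next refl xs≤ys) with Lex-≤⇒≡⊎Lex-< xs≤ys
... | inj₁ refl  = inj₁ refl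
... | inj₂ xs<ys = inj₂ (next refl xs<ys)

-- Exponential weights encoding the decreasing order

module Weight (n : ℕ) where

  -- A base exceeding the length of the vectors, so that a single larger
  -- component outweighs all components of smaller value together.
  b : ℕ
  b = suc (suc n)

  -- The absolute value makes the power defined on all of `ℤ`; monotonicity is claimed from
  -- non-negative arguments upwards, which suits in-degrees.
  weight : ℤ → ℤ
  weight z = + (b ℕ.^ ∣ z ∣)

  0≤weight : ∀ z → 0ℤ ≤ weight z
  0≤weight z = +≤+ z≤n

  0≤listSum : ∀ xs → 0ℤ ≤ listSum weight xs
  0≤listSum []       = ≤-refl
  0≤listSum (x ∷ xs) = +-mono-≤ (0≤weight x) (0≤listSum xs)

  weight-mono-≤ : ∀ {x y} → 0ℤ ≤ x → x ≤ y → weight x ≤ weight y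
  weight-mono-≤ (+≤+ _) (+≤+ k≤l) = +≤+ (ℕ.^-monoʳ-≤ b k≤l)

  listSum-bound : ∀ {x xs} → All (0ℤ ≤_) xs → All (x ≥_) xs → listSum weight xs ≤ + length xs * weight x
  listSum-bound []           []           = ≤-refl
  listSum-bound {x} {y ∷ xs} (0≤y ∷ 0≤xs) (y≤x ∷ xs≤x) =
    subst (_ ≤_) (step (weight x) (+ length xs)) (+-mono-≤ (weight-mono-≤ 0≤y y≤x) (listSum-bound 0≤xs xs≤x))
    where
    step : ∀ w l → w + l * w ≡ (1ℤ + l) * w
    step = solve-∀

  -- Common leading entries cancel. At the first difference `x < y`, the entries from `x` on are
  -- fewer than `b` and each is at most `x`, so together they weigh less than `b` times the weight
  -- of `x`, which is at most the weight of `y`.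
  listSum-mono-< : ∀ {xs ys} → AllPairs _≥_ xs → All (0ℤ ≤_) xs → length xs ℕ.< b →
    Lex-< _≡_ _<_ xs ys → listSum weight xs < listSum weight ys
  listSum-mono-< _ _ _ (halt {y} {ys}) =
    +-mono-<-≤ (+<+ (ℕ.m^n>0 b ∣ y ∣)) (0≤listSum ys)
  listSum-mono-< {x ∷ xs} {y ∷ ys} (x≥xs ∷ _) (0≤x ∷ 0≤xs) len (this x<y) = begin-strict
    listSum weight (x ∷ xs)    ≤⟨ listSum-bound (0≤x ∷ 0≤xs) (≤-refl ∷ x≥xs) ⟩
    + length (x ∷ xs) * weight x ≡⟨ sym (pos-* (length (x ∷ xs)) (b ℕ.^ ∣ x ∣)) ⟩
    + (length (x ∷ xs) ℕ.* b ℕ.^ ∣ x ∣) <⟨ +<+ (ℕ.*-monoˡ-< (b ℕ.^ ∣ x ∣) {{ℕ.m^n≢0 b ∣ x ∣}} len) ⟩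
    + (b ℕ.^ suc ∣ x ∣)        ≤⟨ next-power 0≤x x<y ⟩
    weight y                   ≡⟨ sym (+-identityʳ (weight y)) ⟩
    weight y + 0ℤ              ≤⟨ +-monoʳ-≤ (weight y) (0≤listSum ys) ⟩
    listSum weight (y ∷ ys)    ∎
    where
    open ≤-Reasoning
    next-power : ∀ {x y} → 0ℤ ≤ x → x < y → + (b ℕ.^ suc ∣ x ∣) ≤ weight y
    next-power (+≤+ _) (+<+ k<l) = +≤+ (ℕ.^-monoʳ-≤ b k<l)
  listSum-mono-< {x ∷ xs} (_ ∷ xs↘) (_ ∷ 0≤xs) len (next refl xs<ys) =
    +-monoʳ-< (weight x) (listSum-mono-< xs↘ 0≤xs (ℕ.<-trans (ℕ.n<1+n _) len) xs<ys)

  totalWeight : Vector ℤ n → ℤ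
  totalWeight x = sum (λ v → weight (x v))

  ≤dec⇒↓≡⊎< : ∀ {x y} → NonNegativeVector x → x ≤dec y → x ↓ ≡ y ↓ ⊎ totalWeight x < totalWeight y
  ≤dec⇒↓≡⊎< {x} {y} 0≤x x≤y with Lex-≤⇒≡⊎Lex-< x≤y
  ... | inj₁ x↓≡y↓ = inj₁ x↓≡y↓
  ... | inj₂ x↓<y↓ = inj₂ (subst₂ _<_ (listSum-↓ weight x) (listSum-↓ weight y)
    (listSum-mono-< (↓-decreasing x) (↓-nonneg 0≤x) (subst (ℕ._< b) (sym (↓-length x)) (s≤s (ℕ.n≤1+n n))) x↓<y↓))

  -- Equal sorted lists come from rearranged vectors, so this holds for every `f`; it serves both
  -- `weight` and the square.
  sum-cong-↓ : ∀ f {x y : Vector ℤ n} → x ↓ ≡ y ↓ → sum (λ v → f (x v)) ≡ sum (λ v → f (y v))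
  sum-cong-↓ f {x} {y} x↓≡y↓ = trans (sym (listSum-↓ f x)) (trans (cong (listSum f) x↓≡y↓) (listSum-↓ f y))

  ≤dec⇒≤ : ∀ {x y} → NonNegativeVector x → x ≤dec y → totalWeight x ≤ totalWeight y
  ≤dec⇒≤ 0≤x x≤y with ≤dec⇒↓≡⊎< 0≤x x≤y
  ... | inj₁ x↓≡y↓ = ≤-reflexive (sum-cong-↓ weight x↓≡y↓)
  ... | inj₂ x<y   = <⇒≤ x<y

  -- The lexicographic order is total, and if `y ≤dec x` without equality of the sorted lists, then
  -- `y` would weigh strictly less than `x`.
  ≤⇒≤dec : ∀ {x y} → NonNegativeVector y → totalWeight x ≤ totalWeight y → x ≤dec y
  ≤⇒≤dec {x} {y} 0≤y Wx≤Wy with Lex.≤-total sym <-cmp (x ↓) (y ↓)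
  ... | inj₁ x≤y = x≤y
  ... | inj₂ y≤x with ≤dec⇒↓≡⊎< {y} {x} 0≤y y≤x
  ...   | inj₁ y↓≡x↓ = subst (Lex-≤ _≡_ _<_ (x ↓)) (sym y↓≡x↓) (Lex.≤-reflexive _≡_ _<_ (Pointwise.refl refl))
  ...   | inj₂ Wy<Wx = contradiction Wx≤Wy (<⇒≱ Wy<Wx)

  ≤dec-antisym : ∀ {x y} → NonNegativeVector x → NonNegativeVector y → x ≤dec y → y ≤dec x → x ↓ ≡ y ↓
  ≤dec-antisym {x} {y} 0≤x 0≤y x≤y y≤x with ≤dec⇒↓≡⊎< {x} {y} 0≤x x≤y
  ... | inj₁ x↓≡y↓ = x↓≡y↓
  ... | inj₂ Wx<Wy = contradiction (≤dec⇒≤ {y} {x} 0≤y y≤x) (<⇒≱ Wx<Wy)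

  -- Both weights on the left are at most that of `y - 1`; twice that weight is at most the weight
  -- of `y`, and the positive weight of `x` makes the inequality strict.
  weight-convex : ∀ {x y} → 0ℤ ≤ x → x + + 2 ≤ y → weight (x + 1ℤ) + weight (y - 1ℤ) < weight x + weight y
  weight-convex {+ k} {+ l} _ (+≤+ k+2≤l) with ℕ.m≤n⇒∃[o]m+o≡n (subst (ℕ._≤ l) (ℕ.+-comm k 2) k+2≤l)
  ... | j , refl = +<+ (begin-strict
    b ℕ.^ (k ℕ.+ 1) ℕ.+ b ℕ.^ suc (k ℕ.+ j)
      ≤⟨ ℕ.+-monoˡ-≤ _ (ℕ.^-monoʳ-≤ b (subst (ℕ._≤ suc (k ℕ.+ j)) (ℕ.+-comm 1 k) (s≤s (ℕ.m≤m+n k j)))) ⟩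
    b ℕ.^ suc (k ℕ.+ j) ℕ.+ b ℕ.^ suc (k ℕ.+ j)
      -- As `b` is `suc (suc n)`, the next power unfolds to two copies of this one plus a remainder.
      ≤⟨ ℕ.+-monoʳ-≤ (b ℕ.^ suc (k ℕ.+ j)) (ℕ.m≤m+n _ _) ⟩
    b ℕ.^ suc (suc (k ℕ.+ j))
      <⟨ ℕ.m<n+m _ (ℕ.m^n>0 b k) ⟩
    b ℕ.^ k ℕ.+ b ℕ.^ suc (suc (k ℕ.+ j)) ∎)
    where open ℕ.≤-Reasoning

  -- The weight changes only at `s` and `u`, which are distinct because their components differ; the
  -- net change `up s - down u` is negative by `weight-convex`.
  exchange-< : ∀ (x : Vector ℤ n) {s u} → 0ℤ ≤ x s → x s + + 2 ≤ x u →
    totalWeight (λ v → (x v + χ s v) - χ u v) < totalWeight x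
  exchange-< x {s} {u} 0≤xs xs+2≤xu = begin-strict
    sum (λ v → weight ((x v + χ s v) - χ u v))
      ≡⟨ sum-cong-≗ pointwise ⟩
    sum (λ v → weight (x v) + (χ s v * up v - χ u v * down v))
      ≡⟨ ∑-distrib-+ (λ v → weight (x v)) (λ v → χ s v * up v - χ u v * down v) ⟩
    totalWeight x + sum (λ v → χ s v * up v - χ u v * down v)
      ≡⟨ cong (_+_ (totalWeight x)) (∑-distrib-- (λ v → χ s v * up v) (λ v → χ u v * down v)) ⟩
    totalWeight x + (sum (λ v → χ s v * up v) - sum (λ v → χ u v * down v))
      ≡⟨ cong₂ (λ i j → totalWeight x + (i - j)) (sum-χ s up) (sum-χ u down) ⟩
    totalWeight x + (up s - down u)
      <⟨ +-monoʳ-< (totalWeight x) loss ⟩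
    totalWeight x + 0ℤ
      ≡⟨ +-identityʳ (totalWeight x) ⟩
    totalWeight x ∎
    where
    open ≤-Reasoning
    up down : Vector ℤ n
    up   v = weight (x v + 1ℤ) - weight (x v)
    down v = weight (x v) - weight (x v - 1ℤ)
    regroup : ∀ i j k l → (i - j) - (k - l) ≡ (i + l) - (j + k)
    regroup = solve-∀
    loss : up s - down u < 0ℤ
    loss = subst₂ _<_ (sym (regroup (weight (x s + 1ℤ)) (weight (x s)) (weight (x u)) (weight (x u - 1ℤ))))
      (+-inverseʳ (weight (x s) + weight (x u)))
      (+-monoˡ-< (- (weight (x s) + weight (x u))) (weight-convex 0≤xs xs+2≤xu))
    s≢u : s ≢ u
    s≢u refl = contradiction xs+2≤xu (<⇒≱ (subst (_< x s + + 2) (+-identityʳ (x s)) (+-monoʳ-< (x s) (+<+ (s≤s z≤n)))))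
    at-s : ∀ i j k → i ≡ j + (1ℤ * (i - j) - 0ℤ * k)
    at-s = solve-∀
    at-u : ∀ i j k → i ≡ j + (0ℤ * k - 1ℤ * (j - i))
    at-u = solve-∀
    elsewhere : ∀ j k l → j ≡ j + (0ℤ * k - 0ℤ * l)
    elsewhere = solve-∀
    pointwise : ∀ v → weight ((x v + χ s v) - χ u v) ≡ weight (x v) + (χ s v * up v - χ u v * down v)
    pointwise v with v ≟ s | v ≟ u
    ... | yes refl | yes refl = contradiction refl s≢u
    ... | yes _    | no  _    = trans (cong weight (+-identityʳ (x v + 1ℤ)))
      (at-s (weight (x v + 1ℤ)) (weight (x v)) (down v))
    ... | no  _    | yes _    = trans (cong (λ z → weight (z - 1ℤ)) (+-identityʳ (x v)))
      (at-u (weight (x v - 1ℤ)) (weight (x v)) (up v))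
    ... | no  _    | no  _    = trans (cong weight (trans (+-identityʳ (x v + 0ℤ)) (+-identityʳ (x v))))
      (elsewhere (weight (x v)) (up v) (down v))

-- Orientations compared along the canonical chain

β-1≤β : ∀ β → β - 1ℤ ≤ β
β-1≤β β = i-j≤i β 1ℤ

between⇒≡⊎≡ : ∀ {β a} → β - 1ℤ ≤ a → a ≤ β → a ≡ β ⊎ a ≡ β - 1ℤ
between⇒≡⊎≡ {β} {a} β-1≤a a≤β with a ≤? β - 1ℤ
... | yes a≤β-1 = inj₂ (≤-antisym a≤β-1 β-1≤a)
... | no  a≰β-1 = inj₁ (≤-antisym a≤β (subst (_≤ a) (cancel β) (i<j⇒suc[i]≤j (≰⇒> a≰β-1))))
  where
  cancel : ∀ β → 1ℤ + (β - 1ℤ) ≡ β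
  cancel = solve-∀

≡⊎≡⇒between : ∀ {β a} → a ≡ β ⊎ a ≡ β - 1ℤ → (β - 1ℤ ≤ a) × (a ≤ β)
≡⊎≡⇒between {β} (inj₁ refl) = β-1≤β β , ≤-refl
≡⊎≡⇒between {β} (inj₂ refl) = ≤-refl , β-1≤β β

0≤i*+k : ∀ {i} k → 0ℤ < i → 0ℤ ≤ i * + k
0≤i*+k {+ i} k _ = subst (0ℤ ≤_) (pos-* i k) (+≤+ z≤n)

*-cancelˡ-≡0 : ∀ i {k} → 0ℤ < i → i * + k ≡ 0ℤ → k ≡ 0
*-cancelˡ-≡0 i 0<i eq with i*j≡0⇒i≡0∨j≡0 i eq
... | inj₁ i≡0 = contradiction (sym i≡0) (<⇒≢ 0<i)
... | inj₂ k≡0 = +-injective k≡0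

-- The square of `a` minus the value at `a` of its secant through `β - 1` and `β`. Being a product
-- of consecutive integers, it is non-negative and vanishes exactly at those two points.
slack : ℤ → ℤ → ℤ
slack β a = (a - β) * ((a - β) + 1ℤ)

slack-nonneg : ∀ β a → 0ℤ ≤ slack β a
slack-nonneg β a = pronic (a - β)
  where
  pronic : ∀ t → 0ℤ ≤ t * (t + 1ℤ)
  pronic (+ zero)       = +≤+ z≤n
  pronic +[1+ k ]       = +≤+ z≤n
  pronic -[1+ zero ]    = +≤+ z≤n
  pronic -[1+ (suc k) ] = +≤+ z≤n

slack≡0⇒ : ∀ β a → slack β a ≡ 0ℤ → a ≡ β ⊎ a ≡ β - 1ℤ
slack≡0⇒ β a eq with i*j≡0⇒i≡0∨j≡0 (a - β) eq
... | inj₁ a-β≡0   = inj₁ (i-j≡0⇒i≡j a β a-β≡0)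
... | inj₂ a-β+1≡0 = inj₂ (i-j≡0⇒i≡j a (β - 1ℤ) (trans (regroup a β) a-β+1≡0))
  where
  regroup : ∀ a β → a - (β - 1ℤ) ≡ (a - β) + 1ℤ
  regroup = solve-∀

slack≡0 : ∀ {β a} → a ≡ β ⊎ a ≡ β - 1ℤ → slack β a ≡ 0ℤ
slack≡0 {β} (inj₁ refl) = zero-at-β β
  where
  zero-at-β : ∀ β → (β - β) * ((β - β) + 1ℤ) ≡ 0ℤ
  zero-at-β = solve-∀
slack≡0 {β} (inj₂ refl) = zero-at-β-1 β
  where
  zero-at-β-1 : ∀ β → ((β - 1ℤ) - β) * (((β - 1ℤ) - β) + 1ℤ) ≡ 0ℤ
  zero-at-β-1 = solve-∀

-- On two points every function agrees with the line through its values there.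
affine-on-pair : ∀ (f : ℤ → ℤ) {β a} → a ≡ β ⊎ a ≡ β - 1ℤ → f a ≡ f β + (f β - f (β - 1ℤ)) * (a - β)
affine-on-pair f {β} (inj₁ refl) = at-β (f β) (f (β - 1ℤ)) β
  where
  at-β : ∀ p q β → p ≡ p + (p - q) * (β - β)
  at-β = solve-∀
affine-on-pair f {β} (inj₂ refl) = at-β-1 (f β) (f (β - 1ℤ)) β
  where
  at-β-1 : ∀ p q β → q ≡ p + (p - q) * ((β - 1ℤ) - β)
  at-β-1 = solve-∀

-- The canonical chain and the values of `m` on it

module Chain (G : Graph n) (m : Vector ℤ n) (m-decMin : DecreasinglyMinimal (InDegreeVectors G) m)
  (chain : CanonicalChain (InDegreeVectors G) m) where

  open CanonicalChain chain
  open Weight n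

  private
    K = InDegreeVectors G
    D₀ = proj₁ (proj₁ m-decMin)
    m≗ϱ = proj₂ (proj₁ m-decMin)

  m-nonneg : NonNegativeVector m
  m-nonneg = InDegreeVectors⇒nonneg G (proj₁ m-decMin)

  m-minimal : ∀ {y} → K y → totalWeight m ≤ totalWeight y
  m-minimal {y} Ky = ≤dec⇒≤ {m} {y} m-nonneg (proj₂ m-decMin y Ky)

  T-refl : ∀ s → T K m s s
  T-refl s = D₀ , λ v → trans (cancel (m v) (χ s v)) (m≗ϱ v)
    where
    cancel : ∀ a b → (a + b) - b ≡ a
    cancel = solve-∀

  -- A node of `T K m u` has a walk to `u` in `D₀`; prefixing `e` to a walk from its head gives one
  -- from its tail.
  T-closed : ∀ u e → T K m u (head G D₀ e) → T K m u (tail G D₀ e)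
  T-closed u e (D′ , eq) = proj₁ extended , λ v →
    trans (cong (λ a → (a + χ (tail G D₀ e) v) - χ u v) (m≗ϱ v)) (proj₂ extended v)
    where
    walk = T⇒walk G {D₀} (D′ , λ v →
      trans (cong (λ a → (a + χ (head G D₀ e) v) - χ u v) (sym (m≗ϱ v))) (eq v))
    extended = walk⇒T G (e ∷ proj₂ walk)

  -- With `⇒∈C` this gives all members of the chain one description: at the first one, `β zero` is
  -- the maximum of `m`, so equality and `≥` select the same nodes.
  ∈C⇒ : ∀ i {s} → s ∈ C i → ∃[ u ] (β i ≤ m u × T K m u s)
  ∈C⇒ zero    s∈C with Equivalence.to (C-head _) s∈C
  ... | u , mu≡β , s∈T = u , ≤-reflexive (sym mu≡β) , s∈T
  ∈C⇒ (suc i) s∈C = Equivalence.to (C-step i _) s∈C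

  ⇒∈C : ∀ i {s} u → β i ≤ m u → T K m u s → s ∈ C i
  ⇒∈C zero    u β≤mu s∈T = Equivalence.from (C-head _) (u , ≤-antisym (proj₂ β-head u _) β≤mu , s∈T)
  ⇒∈C (suc i) u β≤mu s∈T = Equivalence.from (C-step i _) (u , β≤mu , s∈T)

  ∉C⇒m<β : ∀ i {s} → s ∉ C i → m s < β i
  ∉C⇒m<β i {s} s∉C = ≰⇒> (λ β≤ms → s∉C (⇒∈C i s β≤ms (T-refl s)))

  -- The value `β (suc i)` is attained outside `C (inject₁ i)`, and `m` is below `β (inject₁ i)`
  -- there because each node lies in its own `T`.
  β-decreasing : ∀ i → β (suc i) < β (inject₁ i)
  β-decreasing i with β-step i
  ... | (s , s∉C , ms≡β) , _ = subst (_< β (inject₁ i)) ms≡β (∉C⇒m<β (inject₁ i) s∉C)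

  C-increasing : ∀ i → C (inject₁ i) ⊆ C (suc i)
  C-increasing i s∈C with ∈C⇒ (inject₁ i) s∈C
  ... | u , β≤mu , s∈T = ⇒∈C (suc i) u (≤-trans (<⇒≤ (β-decreasing i)) β≤mu) s∈T

  S⊆C : ∀ i → S i ⊆ C i
  S⊆C zero    s∈S = s∈S
  S⊆C (suc i) s∈S = p─q⊆p (C (suc i)) (C (inject₁ i)) s∈S

  m-upper : ∀ i {v} → v ∈ S i → m v ≤ β i
  m-upper zero    v∈S = proj₂ β-head _ _
  m-upper (suc i) v∈S = proj₂ (β-step i) _ (x∈p─q⇒x∉q (C (suc i)) (C (inject₁ i)) v∈S)

  -- Some `u` with `m u` at least `β i` has `v` in its `T`. Were `m v` smaller than claimed, moving
  -- a unit from `u` to `v` would stay in `K` and lower the weight.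
  m-lower : ∀ i {v} → v ∈ S i → β i - 1ℤ ≤ m v
  m-lower i {v} v∈S with ∈C⇒ i (S⊆C i v∈S)
  ... | u , β≤mu , v∈T = ≮⇒≥ λ mv<β-1 →
    <⇒≱ (exchange-< m (m-nonneg v) (≤-trans (shift mv<β-1) β≤mu)) (m-minimal v∈T)
    where
    cancel : ∀ β → (β - 1ℤ) + 1ℤ ≡ β
    cancel = solve-∀
    regroup : ∀ a → (1ℤ + a) + 1ℤ ≡ a + + 2
    regroup = solve-∀
    shift : m v < β i - 1ℤ → m v + + 2 ≤ β i
    shift lt = subst₂ _≤_ (regroup (m v)) (cancel (β i)) (+-monoˡ-≤ 1ℤ (i<j⇒suc[i]≤j lt))

  m-values : ∀ i {v} → v ∈ S i → m v ≡ β i ⊎ m v ≡ β i - 1ℤ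
  m-values i v∈S = between⇒≡⊎≡ (m-lower i v∈S) (m-upper i v∈S)

  sumOn-C-suc : ∀ i f → sumOn (C (suc i)) f ≡ sumOn (C (inject₁ i)) f + sumOn (S (suc i)) f
  sumOn-C-suc i f = sumOn-─ (C-increasing i) f

  sumOn-C-last : ∀ f → sumOn (C (fromℕ q-1)) f ≡ sum f
  sumOn-C-last f = trans (cong (λ X → sumOn X f) C-stop) (sumOn-⊤ f)

  module _ (D : Orientation G) where

    private
      y = inDegreeVector G D

    y-nonneg : NonNegativeVector y
    y-nonneg = InDegreeVectors⇒nonneg G (D , λ _ → refl)

    diff : Vector ℤ n
    diff v = y v - m v

    -- The edges inside `C i` contribute equally to both sums, and no arc of `D₀` enters `C i`, a
    -- union of sets closed by `T-closed`.
    sumOn-diff : ∀ i → sumOn (C i) diff ≡ + ϱ-set G D (C i)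
    sumOn-diff i = begin
      sumOn (C i) diff
        ≡⟨ sumOn-distrib-- (C i) y m ⟩
      sumOn (C i) y - sumOn (C i) m
        ≡⟨ cong₂ _-_ (sumOn-ϱ G D (C i))
             (trans (sumOn-cong (C i) (λ v _ → m≗ϱ v)) (sumOn-ϱ G D₀ (C i))) ⟩
      (internalEdges G (C i) + + ϱ-set G D (C i)) - (internalEdges G (C i) + + ϱ-set G D₀ (C i))
        ≡⟨ cong (λ k → (internalEdges G (C i) + + ϱ-set G D (C i)) - (internalEdges G (C i) + + k)) tight ⟩
      (internalEdges G (C i) + + ϱ-set G D (C i)) - (internalEdges G (C i) + 0ℤ)
        ≡⟨ cancel (internalEdges G (C i)) (+ ϱ-set G D (C i)) ⟩
      + ϱ-set G D (C i) ∎
      where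
      open ≡-Reasoning
      cancel : ∀ a b → (a + b) - (a + 0ℤ) ≡ b
      cancel = solve-∀
      tight : ϱ-set G D₀ (C i) ≡ 0
      tight = ϱ-set≡0 G D₀ (C i) λ e h∈C →
        let u , β≤mu , h∈T = ∈C⇒ i h∈C in ⇒∈C i u β≤mu (T-closed u e h∈T)

    ϱ-set-last : ϱ-set G D (C (fromℕ q-1)) ≡ 0
    ϱ-set-last = ϱ-set≡0 G D _ (λ e _ → subst (tail G D e ∈_) (sym C-stop) ∈⊤)

    -- From the cut and value conditions to decreasing minimality

    module Sufficiency (no-entering : ∀ i → ϱ-set G D (C i) ≡ 0)
      (bounds : ∀ i v → v ∈ S i → (β i - 1ℤ ≤ y v) × (y v ≤ β i)) where

      sumOn-C-diff≡0 : ∀ i → sumOn (C i) diff ≡ 0ℤ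
      sumOn-C-diff≡0 i = trans (sumOn-diff i) (cong +_ (no-entering i))

      sumOn-S-diff≡0 : ∀ i → sumOn (S i) diff ≡ 0ℤ
      sumOn-S-diff≡0 zero    = sumOn-C-diff≡0 zero
      sumOn-S-diff≡0 (suc i) = begin
        sumOn (S (suc i)) diff                                ≡⟨ sym (+-identityˡ _) ⟩
        0ℤ + sumOn (S (suc i)) diff                           ≡⟨ cong (_+ sumOn (S (suc i)) diff) (sym (sumOn-C-diff≡0 (inject₁ i))) ⟩
        sumOn (C (inject₁ i)) diff + sumOn (S (suc i)) diff   ≡⟨ sym (sumOn-C-suc i diff) ⟩
        sumOn (C (suc i)) diff                                ≡⟨ sumOn-C-diff≡0 (suc i) ⟩
        0ℤ                                                    ∎
        where open ≡-Reasoning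

      module _ (f : ℤ → ℤ) where

        fdiff : Vector ℤ n
        fdiff v = f (y v) - f (m v)

        -- Both `y` and `m` take only the values `β i - 1` and `β i` on `S i`, so `fdiff` is a
        -- constant multiple of `diff` there.
        sumOn-S-fdiff≡0 : ∀ i → sumOn (S i) fdiff ≡ 0ℤ
        sumOn-S-fdiff≡0 i = begin
          sumOn (S i) fdiff                      ≡⟨ sumOn-cong (S i) affine ⟩
          sumOn (S i) (λ v → slope * diff v)     ≡⟨ sumOn-*ˡ (S i) slope diff ⟩
          slope * sumOn (S i) diff               ≡⟨ cong (slope *_) (sumOn-S-diff≡0 i) ⟩
          slope * 0ℤ                             ≡⟨ *-zeroʳ slope ⟩
          0ℤ                                     ∎
          where
          open ≡-Reasoning
          slope = f (β i) - f (β i - 1ℤ)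
          regroup : ∀ p k a c β → (p + k * (a - β)) - (p + k * (c - β)) ≡ k * (a - c)
          regroup = solve-∀
          affine : ∀ v → v ∈ S i → fdiff v ≡ slope * diff v
          affine v v∈S = trans
            (cong₂ _-_ (affine-on-pair f (between⇒≡⊎≡ (proj₁ (bounds i v v∈S)) (proj₂ (bounds i v v∈S))))
                       (affine-on-pair f (m-values i v∈S)))
            (regroup (f (β i)) slope (y v) (m v) (β i))

        sumOn-C-fdiff≡0 : ∀ i → sumOn (C i) fdiff ≡ 0ℤ
        sumOn-C-fdiff≡0 = <-weakInduction (λ i → sumOn (C i) fdiff ≡ 0ℤ) (sumOn-S-fdiff≡0 zero)
          (λ i ih → trans (sumOn-C-suc i fdiff) (cong₂ _+_ ih (sumOn-S-fdiff≡0 (suc i))))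

        sum-f≡ : sum (λ v → f (y v)) ≡ sum (λ v → f (m v))
        sum-f≡ = i-j≡0⇒i≡j _ _ (begin
          sum (λ v → f (y v)) - sum (λ v → f (m v))  ≡⟨ sym (∑-distrib-- (λ v → f (y v)) (λ v → f (m v))) ⟩
          sum fdiff                                  ≡⟨ sym (sumOn-C-last fdiff) ⟩
          sumOn (C (fromℕ q-1)) fdiff                ≡⟨ sumOn-C-fdiff≡0 (fromℕ q-1) ⟩
          0ℤ                                         ∎)
          where open ≡-Reasoning

      -- By `sum-f≡` the vector `y` has the weight of `m`, the least in `K`.
      decMin : IsDecMinOrientation G D
      decMin = (D , λ _ → refl) , λ z Kz → ≤⇒≤dec {y} {z} (InDegreeVectors⇒nonneg G Kz)
        (subst (_≤ totalWeight z) (sym (sum-f≡ weight)) (m-minimal Kz))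

    -- From decreasing minimality to the cut and value conditions

    module Necessity (D-decMin : IsDecMinOrientation G D) where

      secantSlope : Index → ℤ
      secantSlope i = (β i + β i) - 1ℤ

      square-diff : Vector ℤ n
      square-diff v = y v * y v - m v * m v

      -- The change of the square not accounted for by the secant. It is defined at every node,
      -- since one slope is applied to the whole of `C i`.
      excess : Index → Vector ℤ n
      excess i v = square-diff v - secantSlope i * diff v

      sumOn-excess : ∀ X i → sumOn X (excess i) ≡ sumOn X square-diff - secantSlope i * sumOn X diff
      sumOn-excess X i = trans (sumOn-distrib-- X square-diff (λ v → secantSlope i * diff v))
        (cong (_-_ (sumOn X square-diff)) (sumOn-*ˡ X (secantSlope i) diff))

      -- The constant term of the secant cancels, leaving the slack of `y v` minus that of `m v`,
      -- and `m v` lies on the secant.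
      excess≡slack : ∀ i {v} → v ∈ S i → excess i v ≡ slack (β i) (y v)
      excess≡slack i {v} v∈S = begin
        excess i v                              ≡⟨ expand (y v) (m v) (β i) ⟩
        slack (β i) (y v) - slack (β i) (m v)   ≡⟨ cong (_-_ (slack (β i) (y v))) (slack≡0 (m-values i v∈S)) ⟩
        slack (β i) (y v) - 0ℤ                  ≡⟨ +-identityʳ _ ⟩
        slack (β i) (y v)                       ∎
        where
        open ≡-Reasoning
        expand : ∀ a c β → (a * a - c * c) - ((β + β) - 1ℤ) * (a - c) ≡
          (a - β) * ((a - β) + 1ℤ) - (c - β) * ((c - β) + 1ℤ)
        expand = solve-∀

      excess-nonneg : ∀ i v → v ∈ S i → 0ℤ ≤ excess i v
      excess-nonneg i v v∈S = subst (0ℤ ≤_) (sym (excess≡slack i v∈S)) (slack-nonneg (β i) (y v))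

      drop : Fin q-1 → ℤ
      drop i = secantSlope (inject₁ i) - secantSlope (suc i)

      drop-positive : ∀ i → 0ℤ < drop i
      drop-positive i = subst₂ _<_ (+-inverseʳ (secantSlope (suc i))) refl
        (+-monoˡ-< (- secantSlope (suc i)) (+-monoˡ-< -1ℤ (+-mono-< (β-decreasing i) (β-decreasing i))))

      total : Index → ℤ
      total i = sumOn (C i) (excess i)

      entering : Index → ℤ
      entering i = + ϱ-set G D (C i)

      -- One step of Abel summation: on `C (inject₁ i)` the slope is exchanged for the preceding
      -- one, at a cost of `drop i` times the sum of `diff`, which counts entering arcs.
      total-suc : ∀ i → total (suc i) ≡
        (total (inject₁ i) + drop i * entering (inject₁ i)) + sumOn (S (suc i)) (excess (suc i))
      total-suc i = trans (sumOn-C-suc i (excess (suc i))) (cong (_+ sumOn (S (suc i)) (excess (suc i))) (begin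
        sumOn X (excess (suc i))
          ≡⟨ sumOn-excess X (suc i) ⟩
        sumOn X square-diff - secantSlope (suc i) * sumOn X diff
          ≡⟨ regroup (sumOn X square-diff) (secantSlope (suc i)) (secantSlope (inject₁ i)) (sumOn X diff) ⟩
        (sumOn X square-diff - secantSlope (inject₁ i) * sumOn X diff) + drop i * sumOn X diff
          ≡⟨ cong₂ (λ a z → a + drop i * z) (sym (sumOn-excess X (inject₁ i))) (sumOn-diff (inject₁ i)) ⟩
        total (inject₁ i) + drop i * entering (inject₁ i) ∎))
        where
        open ≡-Reasoning
        X = C (inject₁ i)
        regroup : ∀ a c c′ z → a - c * z ≡ (a - c′ * z) + (c′ - c) * z
        regroup = solve-∀

      0≤drop*entering : ∀ i → 0ℤ ≤ drop i * entering (inject₁ i)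
      0≤drop*entering i = 0≤i*+k (ϱ-set G D (C (inject₁ i))) (drop-positive i)

      0≤sumOn-S : ∀ i → 0ℤ ≤ sumOn (S i) (excess i)
      0≤sumOn-S i = sumOn-nonneg (S i) (excess-nonneg i)

      total-nonneg : ∀ i → 0ℤ ≤ total i
      total-nonneg = <-weakInduction (λ i → 0ℤ ≤ total i) (0≤sumOn-S zero)
        (λ i ih → subst (0ℤ ≤_) (sym (total-suc i))
          (+-mono-≤ (+-mono-≤ ih (0≤drop*entering i)) (0≤sumOn-S (suc i))))

      -- Both vectors are decreasingly minimal, hence rearrangements of each other.
      squares≡ : sum (λ v → y v * y v) ≡ sum (λ v → m v * m v)
      squares≡ = sum-cong-↓ (λ z → z * z) {y} {m}
        (≤dec-antisym {y} {m} y-nonneg m-nonneg (proj₂ D-decMin m (proj₁ m-decMin)) (proj₂ m-decMin y (D , λ _ → refl)))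

      total-last : total (fromℕ q-1) ≡ 0ℤ
      total-last = begin
        total last
          ≡⟨ sumOn-excess (C last) last ⟩
        sumOn (C last) square-diff - secantSlope last * sumOn (C last) diff
          ≡⟨ cong₂ (λ a z → a - secantSlope last * z) squares (trans (sumOn-diff last) (cong +_ ϱ-set-last)) ⟩
        0ℤ - secantSlope last * 0ℤ
          ≡⟨ vanish (secantSlope last) ⟩
        0ℤ ∎
        where
        open ≡-Reasoning
        last = fromℕ q-1
        vanish : ∀ c → 0ℤ - c * 0ℤ ≡ 0ℤ
        vanish = solve-∀
        squares : sumOn (C last) square-diff ≡ 0ℤ
        squares = trans (sumOn-C-last square-diff)
          (trans (∑-distrib-- (λ v → y v * y v) (λ v → m v * m v)) (i≡j⇒i-j≡0 squares≡))

      parts≡0 : ∀ i → total (suc i) ≡ 0ℤ →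
        (total (inject₁ i) ≡ 0ℤ × drop i * entering (inject₁ i) ≡ 0ℤ) × sumOn (S (suc i)) (excess (suc i)) ≡ 0ℤ
      parts≡0 i eq = i+j≡0⇒i≡0×j≡0 {total (inject₁ i)} {gap} 0≤total 0≤gap (proj₁ split) , proj₂ split
        where
        gap     = drop i * entering (inject₁ i)
        0≤total = total-nonneg (inject₁ i)
        0≤gap   = 0≤drop*entering i
        split : total (inject₁ i) + gap ≡ 0ℤ × sumOn (S (suc i)) (excess (suc i)) ≡ 0ℤ
        split = i+j≡0⇒i≡0×j≡0 (+-mono-≤ 0≤total 0≤gap) (0≤sumOn-S (suc i)) (trans (sym (total-suc i)) eq)

      -- Downward induction from the last member: a vanishing `total (suc i)` is a sum of three
      -- non-negative parts, so `total (inject₁ i)` vanishes too, and so does the arc count, as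
      -- `drop i` is positive.
      total≡0×no-entering : ∀ i → total i ≡ 0ℤ × ϱ-set G D (C i) ≡ 0
      total≡0×no-entering = >-weakInduction (λ i → total i ≡ 0ℤ × ϱ-set G D (C i) ≡ 0)
        (total-last , ϱ-set-last) step
        where
        step : ∀ i → total (suc i) ≡ 0ℤ × ϱ-set G D (C (suc i)) ≡ 0 →
          total (inject₁ i) ≡ 0ℤ × ϱ-set G D (C (inject₁ i)) ≡ 0
        step i (eq , _) = proj₁ (proj₁ (parts≡0 i eq)) ,
          *-cancelˡ-≡0 (drop i) (drop-positive i) (proj₂ (proj₁ (parts≡0 i eq)))

      sumOn-S-excess≡0 : ∀ i → sumOn (S i) (excess i) ≡ 0ℤ
      -- Here `S zero` is `C zero`, so the sum is `total zero` itself.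
      sumOn-S-excess≡0 zero    = proj₁ (total≡0×no-entering zero)
      sumOn-S-excess≡0 (suc i) = proj₂ (parts≡0 i (proj₁ (total≡0×no-entering (suc i))))

      bounds : ∀ i v → v ∈ S i → (β i - 1ℤ ≤ y v) × (y v ≤ β i)
      bounds i v v∈S = ≡⊎≡⇒between (slack≡0⇒ (β i) (y v) (trans (sym (excess≡slack i v∈S))
        (sumOn≡0⇒≡0 (S i) (excess-nonneg i) (sumOn-S-excess≡0 i) v v∈S)))

theorem4p7 : ∀ (n : ℕ) (G : Graph n)
    (m : Vector ℤ n) → DecreasinglyMinimal (InDegreeVectors G) m →
    (chain : CanonicalChain (InDegreeVectors G) m) →
    let open CanonicalChain chain in
    ∀ (D : Orientation G) →
    IsDecMinOrientation G D
    ⇔ ((∀ i → ϱ-set G D (C i) ≡ 0)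
    × (∀ i v → v ∈ S i → (β i - 1ℤ ≤ + ϱ G D v) × (+ ϱ G D v ≤ β i)))
theorem4p7 n G m m-decMin chain D = mk⇔
  (λ D-decMin → let open Necessity D D-decMin in (λ i → proj₂ (total≡0×no-entering i)) , bounds)
  (λ (no-entering , bounds) → Sufficiency.decMin D no-entering bounds)
  where open Chain G m m-decMin chain
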